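{- Let $G$ be the $d$-dimensional hypercube, with $n=2^d$ vertices, in which exactly one vertex $s$ is designated as the sink, and let $\sigma$ be a configuration with $N$ chips in total on the non-sink vertices. Then the following greedy simulation algorithm terminates after $O(n^2\log(nN))$ iterations: while some non-sink vertex is full, choose a non-sink vertex $u$ maximizing $\lfloor\sigma_u/\deg(u)\rfloor$, let $k=\lfloor\sigma_u/\deg(u)\rfloor$, set $\sigma_u\leftarrow\sigma_u-k\deg(u)$ and add $k$ chips to every non-sink neighbor of $u$ (one iteration = one execution of this loop body).
   Context: The $d$-dimensional hypercube has vertex set $\{0,1\}^d$, two vertices being adjacent iff they differ in exactly one coordinate. Sandpile with a sink: $\sigma\in\mathbb{N}^{V(G)}$ gives chip counts; the sink never fires and chips sent to it are discarded; a non-sink vertex $v$ is full if $\sigma_v\ge\deg(v)$ (degree counts all neighbors, including $s$); firing $v$ decreases $\sigma_v$ by $\deg(v)$ and adds one chip to each neighbor; a configuration is terminal if no non-sink vertex is full. -}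

module Defs where

open import Data.Nat using (ℕ; zero; suc; _+_; _*_; _∸_; _^_; _≤_)
open import Data.Nat.DivMod using (_/_)
open import Data.Bool using (Bool; true; false; not)
open import Data.Vec using (Vec; []; _∷_; _[_]%=_)
open import Data.Fin using (Fin)
open import Data.List using (List; []; _∷_; _++_; map)
open import Data.Nat.ListAction using (sum)
open import Data.Product using (Σ; ∃; _×_; _,_)
open import Data.Sum using (_⊎_)
open import Relation.Binary.PropositionalEquality using (_≡_; _≢_)
open import Relation.Nullary using (¬_)

Vertex : ℕ → Set
Vertex d = Vec Bool d

allVertices : (d : ℕ) → List (Vertex d)
allVertices zero    = [] ∷ []
allVertices (suc d) = map (false ∷_) (allVertices d) ++ map (true ∷_) (allVertices d)

Adj : {d : ℕ} → Vertex d → Vertex d → Set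
Adj {d} u v = Σ (Fin d) λ i → v ≡ u [ i ]%= not

deg : {d : ℕ} → Vertex d → ℕ
deg {d} _ = d

-- Floor division (the d = 0 case never matters: Q_0 has only the sink).
fdiv : ℕ → ℕ → ℕ
fdiv m zero    = 0
fdiv m (suc k) = m / suc k

Config : ℕ → Set
Config d = Vertex d → ℕ

totalChips : (d : ℕ) → Vertex d → Config d → ℕ
totalChips d s σ = sum (map σ (allVertices d)) ∸ σ s

Full : {d : ℕ} → Config d → Vertex d → Set
Full σ v = deg v ≤ σ v

record GreedyStep {d : ℕ} (s : Vertex d) (σ σ' : Config d) : Set where
  field
    someFull  : ∃ λ w → w ≢ s × Full σ w
    u         : Vertex d
    u≢s       : u ≢ s
    maximal   : ∀ v → v ≢ s → fdiv (σ v) (deg v) ≤ fdiv (σ u) (deg u)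
    at-u      : σ' u ≡ σ u ∸ fdiv (σ u) (deg u) * deg u
    at-nbr    : ∀ v → v ≢ s → Adj u v → σ' v ≡ σ v + fdiv (σ u) (deg u)
    elsewhere : ∀ v → v ≢ u → (¬ Adj u v ⊎ v ≡ s) → σ' v ≡ σ v

data Run {d : ℕ} (s : Vertex d) : Config d → ℕ → Config d → Set where
  done : ∀ {σ} → Run s σ 0 σ
  step : ∀ {σ σ' σ'' m} → GreedyStep s σ σ' → Run s σ' m σ'' → Run s σ (suc m) σ''

{-# OPTIONS --safe #-}

-- Let H v bound from above the expected time a random walk started at v takes to
-- hit s, so that H s = 0 and d * H u ≥ d + (sum of H over the neighbours of u)
-- for u ≢ s.  For the potential Φ σ = Σ σ v * H v, firing u k times lowers Φ by
-- at least k * d.  If k is the maximal quotient, all non-sink vertices hold at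
-- most 2 * k * d chips, and since H ≤ 4 * 2 ^ d on the cube, Φ ≤ 8 * 4 ^ d * (k * d):
-- each iteration removes a fraction 1 / (8 * 4 ^ d) of Φ, and initially
-- Φ ≤ 4 * 2 ^ d * N.
module Submission where

open import Defs
open import Data.Bool using (Bool; true; false; not)
import Data.Bool.Properties as Bool
open import Data.Fin using (zero; suc)
open import Data.List using ([]; _∷_; _++_; map)
open import Data.List.Properties using (map-++; map-∘)
open import Data.Nat hiding (_/_; _%_)
open import Data.Nat.Combinatorics using (_C_; nCk+nC[k+1]≡[n+1]C[k+1]; k>n⇒nCk≡0)
open import Data.Nat.DivMod using (_/_; _%_; m≡m%n+[m/n]*n; m%n<n; m/n*n≤m; m≥n⇒m/n>0)
open import Data.Nat.ListAction using (sum)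
open import Data.Nat.ListAction.Properties using (sum-++)
open import Data.Nat.Logarithm using (⌊log₂_⌋; ⌊log₂⌋-mono-≤; ⌊log₂[2^n]⌋≡n)
open import Data.Nat.Properties
open import Data.Nat.Tactic.RingSolver using (solve-∀)
open import Data.Product using (∃; _,_; proj₁; proj₂)
open import Data.Sum using (inj₁)
open import Data.Vec using ([]; _∷_)
open import Data.Vec.Properties using (∷-injectiveˡ; ∷-injectiveʳ; ≡-dec)
open import Function using (_∘_)
open import Relation.Nullary using (¬_; yes; no; contradiction)
open import Relation.Binary.PropositionalEquality

-- Binomial coefficients and their partial sums.

interchange : ∀ a b c d → (a + b) + (c + d) ≡ (a + c) + (b + d)
interchange = solve-∀

-- The absorption identity, by induction on `n` with Pascal's rule applied on both sides.
[k+1]*[n+1]C[k+1] : ∀ n k → suc k * (suc n C suc k) ≡ suc n * (n C k)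
[k+1]*[n+1]C[k+1] zero    zero    = refl
[k+1]*[n+1]C[k+1] zero    (suc k) = begin
  suc (suc k) * (1 C suc (suc k)) ≡⟨ cong (suc (suc k) *_) (k>n⇒nCk≡0 {1} {suc (suc k)} (s≤s (s≤s z≤n))) ⟩
  suc (suc k) * 0                 ≡⟨ *-zeroʳ (suc (suc k)) ⟩
  0                               ≡⟨ sym (cong (1 *_) (k>n⇒nCk≡0 {0} {suc k} (s≤s z≤n))) ⟩
  1 * (0 C suc k)                 ∎
  where open ≡-Reasoning
[k+1]*[n+1]C[k+1] (suc n) zero    = begin
  1 * (suc (suc n) C 1)           ≡⟨ cong (1 *_) (sym (nCk+nC[k+1]≡[n+1]C[k+1] (suc n) 0)) ⟩
  1 * (1 + (suc n C 1))           ≡⟨ *-identityˡ _ ⟩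
  1 + (suc n C 1)                 ≡⟨ cong suc (trans (sym (*-identityˡ _)) ([k+1]*[n+1]C[k+1] n 0)) ⟩
  suc (suc n) * 1                 ∎
  where open ≡-Reasoning
[k+1]*[n+1]C[k+1] (suc n) (suc k) = begin
  suc (suc k) * (suc (suc n) C suc (suc k))
    ≡⟨ cong (suc (suc k) *_) (sym (nCk+nC[k+1]≡[n+1]C[k+1] (suc n) (suc k))) ⟩
  suc (suc k) * (x + y)
    ≡⟨ expand k x y ⟩
  x + (suc k * x + suc (suc k) * y)
    ≡⟨ cong (x +_) (cong₂ _+_ ([k+1]*[n+1]C[k+1] n k) ([k+1]*[n+1]C[k+1] n (suc k))) ⟩
  x + (suc n * (n C k) + suc n * (n C suc k))
    ≡⟨ cong (x +_) (sym (*-distribˡ-+ (suc n) (n C k) (n C suc k))) ⟩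
  x + suc n * (n C k + n C suc k)
    ≡⟨ cong (λ z → x + suc n * z) (nCk+nC[k+1]≡[n+1]C[k+1] n k) ⟩
  suc (suc n) * x ∎
  where
    open ≡-Reasoning
    x = suc n C suc k
    y = suc n C suc (suc k)
    expand : ∀ k x y → suc (suc k) * (x + y) ≡ x + (suc k * x + suc (suc k) * y)
    expand = solve-∀

[k+1]*nC[k+1] : ∀ {n k} → k ≤ n → suc k * (n C suc k) ≡ (n ∸ k) * (n C k)
[k+1]*nC[k+1] {n} {k} k≤n = +-cancelˡ-≡ (suc k * (n C k)) _ _ (begin
  suc k * (n C k) + suc k * (n C suc k) ≡⟨ sym (*-distribˡ-+ (suc k) (n C k) (n C suc k)) ⟩
  suc k * (n C k + n C suc k)           ≡⟨ cong (suc k *_) (nCk+nC[k+1]≡[n+1]C[k+1] n k) ⟩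
  suc k * (suc n C suc k)               ≡⟨ [k+1]*[n+1]C[k+1] n k ⟩
  suc n * (n C k)                       ≡⟨ cong (λ z → suc z * (n C k)) (sym (m+[n∸m]≡n k≤n)) ⟩
  (suc k + (n ∸ k)) * (n C k)           ≡⟨ *-distribʳ-+ (n C k) (suc k) (n ∸ k) ⟩
  suc k * (n C k) + (n ∸ k) * (n C k)   ∎)
  where open ≡-Reasoning

-- Split `suc n` as `suc k + (n ∸ k)`. The first part becomes a multiple of `n ∸ k` by the preceding
-- identity, and Pascal's rule then merges the two.
[n+1]*nC[k+1] : ∀ {n k} → k ≤ n → suc n * (n C suc k) ≡ (n ∸ k) * (suc n C suc k)
[n+1]*nC[k+1] {n} {k} k≤n = begin
  suc n * (n C suc k)                              ≡⟨ cong (λ z → suc z * (n C suc k)) (sym (m+[n∸m]≡n k≤n)) ⟩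
  (suc k + (n ∸ k)) * (n C suc k)                  ≡⟨ *-distribʳ-+ (n C suc k) (suc k) (n ∸ k) ⟩
  suc k * (n C suc k) + (n ∸ k) * (n C suc k)      ≡⟨ cong (_+ (n ∸ k) * (n C suc k)) ([k+1]*nC[k+1] k≤n) ⟩
  (n ∸ k) * (n C k) + (n ∸ k) * (n C suc k)        ≡⟨ sym (*-distribˡ-+ (n ∸ k) (n C k) (n C suc k)) ⟩
  (n ∸ k) * (n C k + n C suc k)                    ≡⟨ cong ((n ∸ k) *_) (nCk+nC[k+1]≡[n+1]C[k+1] n k) ⟩
  (n ∸ k) * (suc n C suc k)                        ∎
  where open ≡-Reasoning

1≤nCk : ∀ {n k} → k ≤ n → 1 ≤ n C k
1≤nCk {n}     {zero}  _         = ≤-refl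
1≤nCk {suc n} {suc k} (s≤s k≤n) = begin
  1                 ≤⟨ 1≤nCk k≤n ⟩
  n C k             ≤⟨ m≤m+n _ _ ⟩
  n C k + n C suc k ≡⟨ nCk+nC[k+1]≡[n+1]C[k+1] n k ⟩
  suc n C suc k     ∎
  where open ≤-Reasoning

-- Away from both ends of a row, Pascal's rule adds at least 1 each time `n` grows by 1, starting
-- from equality in the column `k = 0`. This is the factor `n` saved on every crossing but the one
-- into `s`.
n≤nC[k+1] : ∀ {n k} → suc k < n → n ≤ n C suc k
n≤nC[k+1] {suc n} {zero} _ = ≤-reflexive (begin
  suc n             ≡⟨ sym (*-identityʳ (suc n)) ⟩
  suc n * 1         ≡⟨ sym ([k+1]*[n+1]C[k+1] n 0) ⟩
  1 * (suc n C 1)   ≡⟨ *-identityˡ _ ⟩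
  suc n C 1         ∎)
  where open ≡-Reasoning
n≤nC[k+1] {suc n} {suc k} (s≤s k+1<n) = begin
  suc n                          ≡⟨ +-comm 1 n ⟩
  n + 1                          ≤⟨ +-mono-≤ (n≤nC[k+1] k+1<n) (1≤nCk k+1<n) ⟩
  n C suc k + n C suc (suc k)    ≡⟨ nCk+nC[k+1]≡[n+1]C[k+1] n (suc k) ⟩
  suc n C suc (suc k)            ∎
  where open ≤-Reasoning

-- The size of a Hamming ball of radius `k` in the `n`-cube.
∑C : ℕ → ℕ → ℕ
∑C n zero    = n C 0
∑C n (suc k) = ∑C n k + n C suc k

-- A ball meets the facet containing its centre in a ball of the same radius, and the opposite facet
-- in one of radius one less.
∑C-suc : ∀ n k → ∑C (suc n) (suc k) ≡ ∑C n k + ∑C n (suc k)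
∑C-suc n zero    = cong suc (sym (nCk+nC[k+1]≡[n+1]C[k+1] n 0))
∑C-suc n (suc k) = begin
  ∑C (suc n) (suc k) + suc n C suc (suc k)
    ≡⟨ cong₂ _+_ (∑C-suc n k) (sym (nCk+nC[k+1]≡[n+1]C[k+1] n (suc k))) ⟩
  (∑C n k + ∑C n (suc k)) + (n C suc k + n C suc (suc k))
    ≡⟨ interchange (∑C n k) (∑C n (suc k)) (n C suc k) (n C suc (suc k)) ⟩
  ∑C n (suc k) + ∑C n (suc (suc k)) ∎
  where open ≡-Reasoning

∑C≤2^n : ∀ n k → ∑C n k ≤ 2 ^ n
∑C≤2^n n       zero    = m^n>0 2 n
∑C≤2^n zero    (suc k) = begin
  ∑C 0 k + 0 C suc k ≡⟨ cong (∑C 0 k +_) (k>n⇒nCk≡0 {0} {suc k} (s≤s z≤n)) ⟩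
  ∑C 0 k + 0         ≡⟨ +-identityʳ _ ⟩
  ∑C 0 k             ≤⟨ ∑C≤2^n 0 k ⟩
  1                  ∎
  where open ≤-Reasoning
∑C≤2^n (suc n) (suc k) = begin
  ∑C (suc n) (suc k)      ≡⟨ ∑C-suc n k ⟩
  ∑C n k + ∑C n (suc k)   ≤⟨ +-mono-≤ (∑C≤2^n n k) (∑C≤2^n n (suc k)) ⟩
  2 ^ n + 2 ^ n           ≡⟨ cong (2 ^ n +_) (sym (+-identityʳ _)) ⟩
  2 ^ suc n               ∎
  where open ≤-Reasoning

-- Times for a random walk to approach the sink.

m<n+[m/n]*n : ∀ m n .{{_ : NonZero n}} → m < n + (m / n) * n
m<n+[m/n]*n m n = begin-strict
  m                   ≡⟨ m≡m%n+[m/n]*n m n ⟩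
  m % n + (m / n) * n <⟨ +-monoˡ-< ((m / n) * n) (m%n<n m n) ⟩
  n + (m / n) * n     ∎
  where open ≤-Reasoning

-- The expected time a random walk on the (n+1)-cube at distance n + 1 ∸ c from s
-- takes to come one step closer, rounded up at each stage of its recursion in c.
crossing : ℕ → ℕ → ℕ
crossing n zero    = 1
crossing n (suc c) = suc ((suc n + suc c * crossing n c) / suc (n ∸ suc c))

-- One-step analysis for `c < n`: a vertex at distance `n ∸ c` has `n ∸ c` neighbours closer to `s`,
-- and each of the `suc c` farther ones costs an extra `crossing n c`. The exact time would give
-- equality; rounding up leaves the inequality that superharmonicity needs.
crossing-lower : ∀ n c → suc n + suc c * crossing n c ≤ suc (n ∸ suc c) * crossing n (suc c)
crossing-lower n c = begin
  suc n + suc c * crossing n c     ≤⟨ <⇒≤ (m<n+[m/n]*n _ (suc (n ∸ suc c))) ⟩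
  crossing n (suc c) * suc (n ∸ suc c) ≡⟨ *-comm (crossing n (suc c)) _ ⟩
  suc (n ∸ suc c) * crossing n (suc c) ∎
  where open ≤-Reasoning

-- Rounding up costs at most one divisor, itself at most `suc n`, which is why the constant term
-- doubles.
crossing-upper : ∀ n c → suc (n ∸ suc c) * crossing n (suc c) ≤ 2 * suc n + suc c * crossing n c
crossing-upper n c = begin
  y * crossing n (suc c)                      ≡⟨ *-comm y _ ⟩
  y + (x / y) * y                             ≤⟨ +-mono-≤ (s≤s (m∸n≤m n (suc c))) (m/n*n≤m x y) ⟩
  suc n + (suc n + suc c * crossing n c)      ≡⟨ regroup (suc n) _ ⟩
  2 * suc n + suc c * crossing n c            ∎
  where
    open ≤-Reasoning
    y = suc (n ∸ suc c)
    x = suc n + suc c * crossing n c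
    regroup : ∀ a b → a + (a + b) ≡ 2 * a + b
    regroup = solve-∀

-- The weight `n C c` makes the recursion telescope: after the two binomial identities both terms
-- carry the factor `n ∸ c`, and cancelling it leaves the increment `2 * (suc n C suc c)`.
nCc*crossing≤ : ∀ n c → c ≤ n → (n C c) * crossing n c ≤ 2 * ∑C (suc n) c
nCc*crossing≤ n zero    _     = s≤s z≤n
nCc*crossing≤ n (suc c) c<n = *-cancelˡ-≤ y (begin
  y * (B′ * crossing n (suc c))                    ≡⟨ swapˡ y B′ _ ⟩
  B′ * (y * crossing n (suc c))                    ≤⟨ *-monoʳ-≤ B′ (crossing-upper n c) ⟩
  B′ * (2 * suc n + suc c * e)                     ≡⟨ expand B′ (suc n) (suc c) e ⟩
  2 * (suc n * B′) + (suc c * B′) * e              ≡⟨ cong₂ (λ p q → 2 * p + q * e) ([n+1]*nC[k+1] c≤n) ([k+1]*nC[k+1] c≤n) ⟩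
  -- The divisor `suc (n ∸ suc c)` is `n ∸ c` here because `c < n`.
  2 * ((n ∸ c) * D) + ((n ∸ c) * (n C c)) * e      ≡⟨ cong (λ z → 2 * (z * D) + (z * (n C c)) * e) n∸c≡y ⟩
  2 * (y * D) + (y * (n C c)) * e                  ≡⟨ factor y D (n C c) e ⟩
  y * (((n C c) * e) + 2 * D)                      ≤⟨ *-monoʳ-≤ y (+-monoˡ-≤ (2 * D) (nCc*crossing≤ n c c≤n)) ⟩
  y * (2 * ∑C (suc n) c + 2 * D)                   ≡⟨ cong (y *_) (sym (*-distribˡ-+ 2 (∑C (suc n) c) D)) ⟩
  y * (2 * ∑C (suc n) (suc c))                     ∎)
  where
    open ≤-Reasoning
    y = suc (n ∸ suc c)
    e = crossing n c
    B′ = n C suc c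
    D = suc n C suc c
    c≤n = <⇒≤ c<n
    n∸c≡y : n ∸ c ≡ y
    n∸c≡y = +-∸-assoc 1 c<n
    swapˡ : ∀ a b c → a * (b * c) ≡ b * (a * c)
    swapˡ = solve-∀
    expand : ∀ b d k e → b * (2 * d + k * e) ≡ 2 * (d * b) + (k * b) * e
    expand = solve-∀
    factor : ∀ y d b e → 2 * (y * d) + (y * b) * e ≡ y * ((b * e) + 2 * d)
    factor = solve-∀

n≤2^n : ∀ n → n ≤ 2 ^ n
n≤2^n zero    = z≤n
n≤2^n (suc n) = begin
  suc n             ≤⟨ +-mono-≤ (m^n>0 2 n) (n≤2^n n) ⟩
  2 ^ n + 2 ^ n     ≡⟨ cong (2 ^ n +_) (sym (+-identityʳ _)) ⟩
  2 ^ suc n         ∎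
  where open ≤-Reasoning

crossing-max : ∀ n → crossing n n ≤ 2 * 2 ^ suc n
crossing-max n = begin
  crossing n n             ≡⟨ sym (*-identityˡ _) ⟩
  1 * crossing n n         ≤⟨ *-monoˡ-≤ (crossing n n) (1≤nCk {n} ≤-refl) ⟩
  (n C n) * crossing n n   ≤⟨ nCc*crossing≤ n n ≤-refl ⟩
  2 * ∑C (suc n) n         ≤⟨ *-monoʳ-≤ 2 (∑C≤2^n (suc n) n) ⟩
  2 * 2 ^ suc n            ∎
  where open ≤-Reasoning

-- For `0 < c < n` the weight `n C c` is at least `n`. At `c = 0` the weight is only 1, but so is
-- the crossing time.
n*crossing≤ : ∀ n c → c < n → n * crossing n c ≤ 2 * 2 ^ suc n
n*crossing≤ n zero    _   = begin
  n * 1               ≡⟨ *-identityʳ n ⟩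
  n                   ≤⟨ n≤1+n n ⟩
  suc n               ≤⟨ n≤2^n (suc n) ⟩
  2 ^ suc n           ≤⟨ m≤n*m (2 ^ suc n) 2 ⟩
  2 * 2 ^ suc n       ∎
  where open ≤-Reasoning
n*crossing≤ n (suc c) c<n = begin
  n * crossing n (suc c)             ≤⟨ *-monoˡ-≤ (crossing n (suc c)) (n≤nC[k+1] c<n) ⟩
  (n C suc c) * crossing n (suc c)   ≤⟨ nCc*crossing≤ n (suc c) (<⇒≤ c<n) ⟩
  2 * ∑C (suc n) (suc c)             ≤⟨ *-monoʳ-≤ 2 (∑C≤2^n (suc n) (suc c)) ⟩
  2 * 2 ^ suc n                      ∎
  where open ≤-Reasoning

-- A walk from distance `suc r` must pass through distance `r` first; at distance `suc r` the
-- parameter of `crossing` is `n ∸ r`.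
hitting : ℕ → ℕ → ℕ
hitting n zero    = 0
hitting n (suc r) = hitting n r + crossing n (n ∸ r)

-- Each crossing except the one into s is cheaper than the latter by a factor n,
-- so together they cost about as much as that one.
n*hitting≤ : ∀ n i → i ≤ n → n * hitting n (suc i) ≤ (n + i) * (2 * 2 ^ suc n)
n*hitting≤ n zero    _   = begin
  n * crossing n n           ≤⟨ *-monoʳ-≤ n (crossing-max n) ⟩
  n * (2 * 2 ^ suc n)        ≡⟨ cong (_* (2 * 2 ^ suc n)) (sym (+-identityʳ n)) ⟩
  (n + 0) * (2 * 2 ^ suc n)  ∎
  where open ≤-Reasoning
n*hitting≤ n (suc i) i<n = begin
  n * (hitting n (suc i) + crossing n (n ∸ suc i))
    ≡⟨ *-distribˡ-+ n _ _ ⟩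
  n * hitting n (suc i) + n * crossing n (n ∸ suc i)
    ≤⟨ +-mono-≤ (n*hitting≤ n i (<⇒≤ i<n)) (n*crossing≤ n (n ∸ suc i) (∸-monoʳ-< z<s i<n)) ⟩
  (n + i) * (2 * 2 ^ suc n) + 2 * 2 ^ suc n
    ≡⟨ collect n i (2 * 2 ^ suc n) ⟩
  (n + suc i) * (2 * 2 ^ suc n) ∎
  where
    open ≤-Reasoning
    collect : ∀ n i q → (n + i) * q + q ≡ (n + suc i) * q
    collect = solve-∀

hitting-mono : ∀ n {r r′} → r ≤′ r′ → hitting n r ≤ hitting n r′
hitting-mono n ≤′-refl       = ≤-refl
hitting-mono n (≤′-step r≤r′) = ≤-trans (hitting-mono n r≤r′) (m≤m+n _ _)

hitting-max : ∀ n → hitting n (suc n) ≤ 4 * 2 ^ suc n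
-- The factor `n` cannot be cancelled here; the value is 1.
hitting-max zero      = s≤s z≤n
hitting-max n@(suc _) = *-cancelˡ-≤ n (begin
  n * hitting n (suc n)         ≤⟨ n*hitting≤ n n ≤-refl ⟩
  (n + n) * (2 * 2 ^ suc n)     ≡⟨ collect n (2 ^ suc n) ⟩
  n * (4 * 2 ^ suc n)           ∎)
  where
    open ≤-Reasoning
    collect : ∀ n v → (n + n) * (2 * v) ≡ n * (4 * v)
    collect = solve-∀

hitting≤ : ∀ n {r} → r ≤ suc n → hitting n r ≤ 4 * 2 ^ suc n
hitting≤ n r≤n+1 = ≤-trans (hitting-mono n (≤⇒≤′ r≤n+1)) (hitting-max n)

m+n≡o⇒o∸m≡n : ∀ {m n o} → m + n ≡ o → o ∸ m ≡ n
m+n≡o⇒o∸m≡n {m} {n} refl = m+n∸m≡n m n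

-- A vertex at distance `suc r` has `suc r` closer and `c` farther neighbours. Expanding `hitting`
-- in crossings reduces the claim to `crossing-lower`; at the antipode of `s`, where `c = 0`, it is
-- an equality because `crossing n 0` is 1.
hitting-superharmonic : ∀ n r c → r + c ≡ n →
  suc n + (suc r * hitting n r + c * hitting n (suc (suc r))) ≤ suc n * hitting n (suc r)
hitting-superharmonic n r zero    r+0≡n = ≤-reflexive (begin
  suc n + (suc r * hitting n r + 0)   ≡⟨ cong (λ m → suc n + (suc m * hitting n r + 0)) r≡n ⟩
  suc n + (suc n * hitting n r + 0)   ≡⟨ collect (suc n) (hitting n r) ⟩
  suc n * (hitting n r + 1)           ≡⟨ cong (λ m → suc n * (hitting n r + crossing n m)) (sym (m+n≡o⇒o∸m≡n {r} {0} r+0≡n)) ⟩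
  suc n * hitting n (suc r)           ∎)
  where
    open ≡-Reasoning
    r≡n = trans (sym (+-identityʳ r)) r+0≡n
    collect : ∀ d h → d + (d * h + 0) ≡ d * (h + 1)
    collect = solve-∀
hitting-superharmonic n r (suc c) r+c≡n = begin
  suc n + (suc r * h + suc c * (h + crossing n (n ∸ r) + crossing n (n ∸ suc r)))
    ≡⟨ cong₂ (λ p q → suc n + (suc r * h + suc c * (h + crossing n p + crossing n q))) n∸r n∸r∸1 ⟩
  suc n + (suc r * h + suc c * (h + e′ + e))
    ≡⟨ regroup (suc n) r c h e′ e ⟩
  (suc r + suc c) * h + suc c * e′ + (suc n + suc c * e)
    ≤⟨ +-monoʳ-≤ ((suc r + suc c) * h + suc c * e′) (crossing-lower n c) ⟩
  (suc r + suc c) * h + suc c * e′ + suc (n ∸ suc c) * e′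
    ≡⟨ cong (λ m → (suc r + suc c) * h + suc c * e′ + suc m * e′) n∸c∸1 ⟩
  (suc r + suc c) * h + suc c * e′ + suc r * e′
    ≡⟨ collect r c h e′ ⟩
  suc (r + suc c) * (h + e′)
    ≡⟨ cong₂ (λ m p → suc m * (h + crossing n p)) r+c≡n (sym n∸r) ⟩
  suc n * hitting n (suc r) ∎
  where
    open ≤-Reasoning
    h = hitting n r
    e = crossing n c
    e′ = crossing n (suc c)
    n∸r : n ∸ r ≡ suc c
    n∸r = m+n≡o⇒o∸m≡n {r} r+c≡n
    n∸r∸1 : n ∸ suc r ≡ c
    n∸r∸1 = m+n≡o⇒o∸m≡n (trans (sym (+-suc r c)) r+c≡n)
    n∸c∸1 : n ∸ suc c ≡ r
    n∸c∸1 = m+n≡o⇒o∸m≡n (trans (+-comm (suc c) r) r+c≡n)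
    regroup : ∀ d r c h e′ e → d + (suc r * h + suc c * (h + e′ + e)) ≡ (suc r + suc c) * h + suc c * e′ + (d + suc c * e)
    regroup = solve-∀
    collect : ∀ r c h e′ → (suc r + suc c) * h + suc c * e′ + suc r * e′ ≡ suc (r + suc c) * (h + e′)
    collect = solve-∀

-- Sums over the vertices of the cube.

∑ : ∀ {d} → (Vertex d → ℕ) → ℕ
∑ {zero}  f = f []
∑ {suc d} f = ∑ (f ∘ (false ∷_)) + ∑ (f ∘ (true ∷_))

-- Links the list sum in `totalChips` to `∑`, whose recursion on the dimension suits induction on a
-- vertex.
sum-allVertices : ∀ {d} (f : Vertex d → ℕ) → sum (map f (allVertices d)) ≡ ∑ f
sum-allVertices {zero}  f = +-identityʳ (f [])
sum-allVertices {suc d} f = begin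
  sum (map f (map (false ∷_) vs ++ map (true ∷_) vs))
    ≡⟨ cong sum (map-++ f (map (false ∷_) vs) _) ⟩
  sum (map f (map (false ∷_) vs) ++ map f (map (true ∷_) vs))
    ≡⟨ sum-++ (map f (map (false ∷_) vs)) _ ⟩
  sum (map f (map (false ∷_) vs)) + sum (map f (map (true ∷_) vs))
    ≡⟨ cong₂ (λ xs ys → sum xs + sum ys) (map-∘ vs) (map-∘ vs) ⟨
  sum (map (f ∘ (false ∷_)) vs) + sum (map (f ∘ (true ∷_)) vs)
    ≡⟨ cong₂ _+_ (sum-allVertices (f ∘ (false ∷_))) (sum-allVertices (f ∘ (true ∷_))) ⟩
  ∑ f ∎
  where
    open ≡-Reasoning
    vs = allVertices d

∑-mono : ∀ {d} {f g : Vertex d → ℕ} → (∀ v → f v ≤ g v) → ∑ f ≤ ∑ g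
∑-mono {zero}  f≤g = f≤g []
∑-mono {suc d} f≤g = +-mono-≤ (∑-mono (f≤g ∘ (false ∷_))) (∑-mono (f≤g ∘ (true ∷_)))

∑-+ : ∀ {d} (f g : Vertex d → ℕ) → ∑ (λ v → f v + g v) ≡ ∑ f + ∑ g
∑-+ {zero}  f g = refl
∑-+ {suc d} f g = trans (cong₂ _+_ (∑-+ {d} _ _) (∑-+ {d} _ _)) (interchange (∑ (f ∘ (false ∷_))) _ _ _)

∑-*ˡ : ∀ {d} c (f : Vertex d → ℕ) → ∑ (λ v → c * f v) ≡ c * ∑ f
∑-*ˡ {zero}  c f = refl
∑-*ˡ {suc d} c f = trans (cong₂ _+_ (∑-*ˡ {d} c _) (∑-*ˡ {d} c _)) (sym (*-distribˡ-+ c (∑ (f ∘ (false ∷_))) _))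

∑-const : ∀ d c → ∑ {d} (λ _ → c) ≡ 2 ^ d * c
∑-const zero    c = sym (+-identityʳ c)
∑-const (suc d) c = trans (cong₂ _+_ (∑-const d c) (∑-const d c)) (collect (2 ^ d) c)
  where
    collect : ∀ p c → p * c + p * c ≡ 2 * p * c
    collect = solve-∀

-- Numerical indicators of equality and adjacency.

δ : ∀ {d} → Vertex d → Vertex d → ℕ
δ []          []          = 1
δ (false ∷ u) (false ∷ v) = δ u v
δ (false ∷ u) (true  ∷ v) = 0
δ (true  ∷ u) (false ∷ v) = 0
δ (true  ∷ u) (true  ∷ v) = δ u v

-- If the leading coordinates differ, adjacency forces equal tails, hence `δ`. Being numerical, it
-- turns sums over neighbours into instances of `∑`.
adj : ∀ {d} → Vertex d → Vertex d → ℕ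
adj []          []          = 0
adj (false ∷ u) (false ∷ v) = adj u v
adj (false ∷ u) (true  ∷ v) = δ u v
adj (true  ∷ u) (false ∷ v) = δ u v
adj (true  ∷ u) (true  ∷ v) = adj u v

-- Indexed by the values of `δ` and `adj`, so that one case split yields both the indicators and the
-- propositions needed to apply a `GreedyStep`.
data Position {d} (u v : Vertex d) : ℕ → ℕ → Set where
  here : v ≡ u → Position u v 1 0
  near : v ≢ u → Adj u v → Position u v 0 1
  far  : v ≢ u → ¬ Adj u v → Position u v 0 0

position : ∀ {d} (u v : Vertex d) → Position u v (δ u v) (adj u v)
position []      []      = here refl
position (a ∷ u) (b ∷ v) = cons a b (position u v)
  where
    same : ∀ a {x y} → Position u v x y → Position (a ∷ u) (a ∷ v) x y
    same a (here refl)         = here refl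
    same a (near v≢u (i , eq)) = near (v≢u ∘ ∷-injectiveʳ) (suc i , cong (a ∷_) eq)
    same a (far v≢u ¬adj)      = far (v≢u ∘ ∷-injectiveʳ)
      λ { (zero , eq) → contradiction (∷-injectiveˡ eq) (Bool.not-¬ refl)
        ; (suc i , eq) → ¬adj (i , ∷-injectiveʳ eq) }
    apart : ∀ a → v ≢ u → Position (a ∷ u) (not a ∷ v) 0 0
    apart a v≢u = far (Bool.not-¬ refl ∘ sym ∘ ∷-injectiveˡ)
      λ { (zero , eq) → v≢u (∷-injectiveʳ eq) ; (suc i , eq) → Bool.not-¬ refl (sym (∷-injectiveˡ eq)) }
    flipped : ∀ a {x y} → Position u v x y → Position (a ∷ u) (not a ∷ v) 0 x
    flipped a (here refl)    = near (Bool.not-¬ refl ∘ sym ∘ ∷-injectiveˡ) (zero , refl)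
    flipped a (near v≢u _) = apart a v≢u
    flipped a (far v≢u _)  = apart a v≢u
    cons : ∀ a b → Position u v (δ u v) (adj u v) → Position (a ∷ u) (b ∷ v) (δ (a ∷ u) (b ∷ v)) (adj (a ∷ u) (b ∷ v))
    cons false false = same false
    cons false true  = flipped false
    cons true  false = flipped true
    cons true  true  = same true

∑-δ : ∀ {d} (u : Vertex d) (f : Vertex d → ℕ) → ∑ (λ v → δ u v * f v) ≡ f u
∑-δ []          f = +-identityʳ (f [])
∑-δ (false ∷ u) f = trans (cong₂ _+_ (∑-δ u _) (∑-*ˡ 0 (f ∘ (true ∷_)))) (+-identityʳ _)
∑-δ (true  ∷ u) f = cong₂ _+_ (∑-*ˡ 0 (f ∘ (false ∷_))) (∑-δ u _)

-- Hamming distance and sums over neighbours.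

dist : ∀ {d} → Vertex d → Vertex d → ℕ
dist []          []          = 0
dist (false ∷ v) (false ∷ s) = dist v s
dist (false ∷ v) (true  ∷ s) = suc (dist v s)
dist (true  ∷ v) (false ∷ s) = suc (dist v s)
dist (true  ∷ v) (true  ∷ s) = dist v s

agreement : ∀ {d} → Vertex d → Vertex d → ℕ
agreement []          []          = 0
agreement (false ∷ v) (false ∷ s) = suc (agreement v s)
agreement (false ∷ v) (true  ∷ s) = agreement v s
agreement (true  ∷ v) (false ∷ s) = agreement v s
agreement (true  ∷ v) (true  ∷ s) = suc (agreement v s)

dist+agreement : ∀ {d} (v s : Vertex d) → dist v s + agreement v s ≡ d
dist+agreement []          []          = refl
dist+agreement (false ∷ v) (false ∷ s) = trans (+-suc _ _) (cong suc (dist+agreement v s))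
dist+agreement (false ∷ v) (true  ∷ s) = cong suc (dist+agreement v s)
dist+agreement (true  ∷ v) (false ∷ s) = cong suc (dist+agreement v s)
dist+agreement (true  ∷ v) (true  ∷ s) = trans (+-suc _ _) (cong suc (dist+agreement v s))

dist-refl : ∀ {d} (s : Vertex d) → dist s s ≡ 0
dist-refl []          = refl
dist-refl (false ∷ s) = dist-refl s
dist-refl (true  ∷ s) = dist-refl s

dist≡0⇒≡ : ∀ {d} (v s : Vertex d) → dist v s ≡ 0 → v ≡ s
dist≡0⇒≡ []          []          _  = refl
dist≡0⇒≡ (false ∷ v) (false ∷ s) eq = cong (false ∷_) (dist≡0⇒≡ v s eq)
dist≡0⇒≡ (true  ∷ v) (true  ∷ s) eq = cong (true ∷_) (dist≡0⇒≡ v s eq)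

-- Flipping a coordinate where `u` and `s` differ lowers the distance, flipping any other raises it.
-- The function `h` is arbitrary so that the induction can pass to `h ∘ suc` when the leading
-- coordinates differ.
∑-adj-dist : ∀ {d} (u s : Vertex d) (h : ℕ → ℕ) →
  ∑ (λ v → adj u v * h (dist v s)) ≡ dist u s * h (pred (dist u s)) + agreement u s * h (suc (dist u s))
∑-adj-dist []          []          h = refl
∑-adj-dist (a ∷ u) (b ∷ s) h = cons a b
  where
    r = dist u s
    c = agreement u s
    Goal : Bool → Bool → Set
    Goal a b = ∑ (λ v → adj (a ∷ u) v * h (dist v (b ∷ s)))
      ≡ dist (a ∷ u) (b ∷ s) * h (pred (dist (a ∷ u) (b ∷ s))) + agreement (a ∷ u) (b ∷ s) * h (suc (dist (a ∷ u) (b ∷ s)))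
    closer : ∀ r c (h : ℕ → ℕ) → (r * h (suc (pred r)) + c * h (suc (suc r))) + h r ≡ suc r * h r + c * h (suc (suc r))
    -- Here `suc (pred r)` is not `r`, but the coefficient `r` is zero.
    closer zero    c h = swap (c * h 2) (h 0)
      where
        swap : ∀ x z → x + z ≡ 1 * z + x
        swap = solve-∀
    closer (suc r) c h = swap (suc r * h (suc r)) _ _
      where
        swap : ∀ x y z → (x + y) + z ≡ (z + x) + y
        swap = solve-∀
    farther : ∀ x c z → (x + c * z) + z ≡ x + suc c * z
    farther = solve-∀
    cons : ∀ a b → Goal a b
    cons false false = trans (cong₂ _+_ (∑-adj-dist u s h) (∑-δ u _)) (farther (r * h (pred r)) c _)
    cons false true  = trans (cong₂ _+_ (∑-adj-dist u s (h ∘ suc)) (∑-δ u _)) (closer r c h)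
    cons true  false = trans (+-comm (∑ (λ v → δ u v * h (dist v s))) _)
      (trans (cong₂ _+_ (∑-adj-dist u s (h ∘ suc)) (∑-δ u _)) (closer r c h))
    cons true  true  = trans (+-comm (∑ (λ v → δ u v * h (suc (dist v s)))) _)
      (trans (cong₂ _+_ (∑-adj-dist u s h) (∑-δ u _)) (farther (r * h (pred r)) c _))

-- Effect of one iteration on a weighted chip count.

∑-firing : ∀ {d} {s : Vertex d} {σ σ′} (g : Vertex d → ℕ) → g s ≡ 0 → (st : GreedyStep s σ σ′) →
  let open GreedyStep st ; k = fdiv (σ u) (deg u) in
  ∑ (λ v → σ′ v * g v) + k * deg u * g u ≤ ∑ (λ v → σ v * g v) + k * ∑ (λ v → adj u v * g v)
-- The chips leaving `u` are an added term on the left, which avoids truncated subtraction, and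
-- `δ u` spreads that term over all vertices for a pointwise comparison.
∑-firing {d} {s} {σ} {σ′} g gs≡0 st = begin
  ∑ (λ v → σ′ v * g v) + k * deg u * g u
    ≡⟨ cong (∑ (λ v → σ′ v * g v) +_) (∑-δ u (λ v → k * deg u * g v)) ⟨
  ∑ (λ v → σ′ v * g v) + ∑ (λ v → δ u v * (k * deg u * g v))
    ≡⟨ ∑-+ (λ v → σ′ v * g v) _ ⟨
  ∑ (λ v → σ′ v * g v + δ u v * (k * deg u * g v))
    ≤⟨ ∑-mono (λ v → pointwise v (position u v)) ⟩
  ∑ (λ v → σ v * g v + k * (adj u v * g v))
    ≡⟨ ∑-+ (λ v → σ v * g v) _ ⟩
  ∑ (λ v → σ v * g v) + ∑ (λ v → k * (adj u v * g v))
    ≡⟨ cong (∑ (λ v → σ v * g v) +_) (∑-*ˡ k (λ v → adj u v * g v)) ⟩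
  ∑ (λ v → σ v * g v) + k * ∑ (λ v → adj u v * g v) ∎
  where
    open ≤-Reasoning
    open GreedyStep st
    k = fdiv (σ u) (deg u)
    fdiv*≤ : ∀ m d → fdiv m d * d ≤ m
    fdiv*≤ m zero    = z≤n
    fdiv*≤ m (suc d) = m/n*n≤m m (suc d)
    pointwise : ∀ v {x y} → Position u v x y → σ′ v * g v + x * (k * deg u * g v) ≤ σ v * g v + k * (y * g v)
    pointwise v (here refl) = begin
      σ′ u * g u + 1 * (k * deg u * g u)           ≡⟨ cong (λ z → z * g u + 1 * (k * deg u * g u)) at-u ⟩
      (σ u ∸ k * deg u) * g u + 1 * (k * deg u * g u) ≡⟨ collect (σ u ∸ k * deg u) (k * deg u) (g u) ⟩
      (σ u ∸ k * deg u + k * deg u) * g u          ≡⟨ cong (_* g u) (m∸n+n≡m (fdiv*≤ (σ u) (deg u))) ⟩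
      σ u * g u                                    ≤⟨ m≤m+n _ _ ⟩
      σ u * g u + k * (0 * g u)                    ∎
      where
        collect : ∀ a b g → a * g + 1 * (b * g) ≡ (a + b) * g
        collect = solve-∀
    pointwise v (near v≢u u~v) with ≡-dec Bool._≟_ v s
    -- Chips sent to the sink are discarded, which is harmless as `g` vanishes there.
    ... | yes refl = begin
      σ′ v * g v + 0   ≡⟨ cong (λ z → σ′ v * z + 0) gs≡0 ⟩
      σ′ v * 0 + 0     ≡⟨ cong (_+ 0) (*-zeroʳ (σ′ v)) ⟩
      0                ≤⟨ z≤n ⟩
      σ v * g v + k * (1 * g v) ∎
    ... | no v≢s = begin
      σ′ v * g v + 0            ≡⟨ cong (λ z → z * g v + 0) (at-nbr v v≢s u~v) ⟩
      (σ v + k) * g v + 0       ≡⟨ expand (σ v) k (g v) ⟩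
      σ v * g v + k * (1 * g v) ∎
      where
        expand : ∀ a k g → (a + k) * g + 0 ≡ a * g + k * (1 * g)
        expand = solve-∀
    pointwise v (far v≢u u≁v) = begin
      σ′ v * g v + 0            ≡⟨ cong (λ z → z * g v + 0) (elsewhere v v≢u (inj₁ u≁v)) ⟩
      σ v * g v + 0             ≤⟨ +-monoʳ-≤ (σ v * g v) z≤n ⟩
      σ v * g v + k * (0 * g v) ∎

-- The potential and its decay.

module Potential {n : ℕ} (s : Vertex (suc n)) where

  weight : Vertex (suc n) → ℕ
  weight v = hitting n (dist v s)

  Φ : Config (suc n) → ℕ
  Φ σ = ∑ (λ v → σ v * weight v)

  weight-sink : weight s ≡ 0
  weight-sink = cong (hitting n) (dist-refl s)

  weight≤ : ∀ v → weight v ≤ 4 * 2 ^ suc n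
  weight≤ v = hitting≤ n (m+n≤o⇒m≤o (dist v s) (≤-reflexive (dist+agreement v s)))

  weight-superharmonic : ∀ u → u ≢ s → suc n + ∑ (λ v → adj u v * weight v) ≤ suc n * weight u
  weight-superharmonic u u≢s
    rewrite ∑-adj-dist u s (hitting n) with dist u s in eq | dist+agreement u s
  ... | zero  | _     = contradiction (dist≡0⇒≡ u s eq) u≢s
  ... | suc r | r+c≡n = hitting-superharmonic n r (agreement u s) (suc-injective r+c≡n)

  chipsFired : ∀ {σ σ′} → GreedyStep s σ σ′ → ℕ
  chipsFired {σ} st = fdiv (σ u) (suc n) * suc n
    where open GreedyStep st

  -- By superharmonicity each of the `k` firings removes weight `suc n * weight u` and returns at
  -- least `suc n` less. The returned weight `k * N` is added to both sides and cancelled.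
  Φ-decrease : ∀ {σ σ′} (st : GreedyStep s σ σ′) → Φ σ′ + chipsFired st ≤ Φ σ
  Φ-decrease {σ} {σ′} st = +-cancelʳ-≤ (k * N) _ _ (begin
    Φ σ′ + k * suc n + k * N          ≡⟨ regroup (Φ σ′) k (suc n) N ⟩
    Φ σ′ + k * (suc n + N)            ≤⟨ +-monoʳ-≤ (Φ σ′) (*-monoʳ-≤ k (weight-superharmonic u u≢s)) ⟩
    Φ σ′ + k * (suc n * weight u)     ≡⟨ cong (Φ σ′ +_) (*-assoc k (suc n) (weight u)) ⟨
    Φ σ′ + k * suc n * weight u       ≤⟨ ∑-firing weight weight-sink st ⟩
    Φ σ + k * N                       ∎)
    where
      open ≤-Reasoning
      open GreedyStep st
      k = fdiv (σ u) (suc n)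
      N = ∑ (λ v → adj u v * weight v)
      regroup : ∀ a k d N → a + k * d + k * N ≡ a + k * (d + N)
      regroup = solve-∀

  1≤quotient : ∀ {σ σ′} (st : GreedyStep s σ σ′) → let open GreedyStep st in 1 ≤ fdiv (σ u) (suc n)
  1≤quotient st = ≤-trans (m≥n⇒m/n>0 (proj₂ (proj₂ someFull))) (maximal _ (proj₁ (proj₂ someFull)))
    where open GreedyStep st

  1≤chipsFired : ∀ {σ σ′} (st : GreedyStep s σ σ′) → 1 ≤ chipsFired st
  1≤chipsFired st = *-mono-≤ (1≤quotient st) (s≤s z≤n)

  -- The product of `2 ^ suc n` vertices, the factor 2 bounding chips per vertex by
  -- `2 * chipsFired`, and the maximal weight `4 * 2 ^ suc n`.
  D : ℕ
  D = 8 * (2 ^ suc n * 2 ^ suc n)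

  Φ≤D*chipsFired : ∀ {σ σ′} (st : GreedyStep s σ σ′) → Φ σ ≤ D * chipsFired st
  Φ≤D*chipsFired {σ} st = begin
    Φ σ                              ≤⟨ ∑-mono pointwise ⟩
    ∑ {suc n} (λ _ → 2 * f * (4 * V))        ≡⟨ ∑-const (suc n) _ ⟩
    V * (2 * f * (4 * V))            ≡⟨ collect V f ⟩
    D * f                            ∎
    where
      open ≤-Reasoning
      open GreedyStep st
      V = 2 ^ suc n
      k = fdiv (σ u) (suc n)
      f = chipsFired st
      collect : ∀ v f → v * (2 * f * (4 * v)) ≡ 8 * (v * v) * f
      collect = solve-∀
      double : ∀ k d → k * d + k * d ≡ 2 * (k * d)
      double = solve-∀
      few : ∀ v → v ≢ s → σ v ≤ 2 * f
      few v v≢s = begin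
        σ v                                  ≤⟨ <⇒≤ (m<n+[m/n]*n (σ v) (suc n)) ⟩
        suc n + fdiv (σ v) (suc n) * suc n   ≤⟨ +-monoʳ-≤ (suc n) (*-monoˡ-≤ (suc n) (maximal v v≢s)) ⟩
        -- A full vertex exists, so `k` is at least 1 and `k * suc n` absorbs the remainder.
        suc n + k * suc n                    ≤⟨ +-monoˡ-≤ (k * suc n) (m≤n*m (suc n) k {{>-nonZero (1≤quotient st)}}) ⟩
        k * suc n + k * suc n                ≡⟨ double k (suc n) ⟩
        2 * f                                ∎
      pointwise : ∀ v → σ v * weight v ≤ 2 * f * (4 * V)
      pointwise v with ≡-dec Bool._≟_ v s
      ... | no v≢s = *-mono-≤ (few v v≢s) (weight≤ v)
      ... | yes refl = begin
        σ v * weight v   ≡⟨ cong (σ v *_) weight-sink ⟩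
        σ v * 0          ≡⟨ *-zeroʳ (σ v) ⟩
        0                ≤⟨ z≤n ⟩
        2 * f * (4 * V)  ∎

  -- Since the sink has weight 0, `M * σ s` fits beside `Φ σ` under `M * ∑ σ`, and can then be moved
  -- across as the subtraction in `totalChips`.
  Φ≤totalChips : ∀ σ → Φ σ ≤ 4 * (2 ^ suc n * totalChips (suc n) s σ)
  Φ≤totalChips σ = begin
    Φ σ                                          ≤⟨ m+n≤o⇒m≤o∸n (Φ σ) withSink ⟩
    M * ∑ σ ∸ M * σ s                            ≡⟨ *-distribˡ-∸ M (∑ σ) (σ s) ⟨
    M * (∑ σ ∸ σ s)                              ≡⟨ cong (λ z → M * (z ∸ σ s)) (sum-allVertices σ) ⟨
    M * totalChips (suc n) s σ                   ≡⟨ *-assoc 4 (2 ^ suc n) _ ⟩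
    4 * (2 ^ suc n * totalChips (suc n) s σ)     ∎
    where
      open ≤-Reasoning
      M = 4 * 2 ^ suc n
      awayFromSink : ∀ v → σ v * weight v + 0 ≤ M * σ v
      awayFromSink v = begin
        σ v * weight v + 0   ≡⟨ +-identityʳ _ ⟩
        σ v * weight v       ≤⟨ *-monoʳ-≤ (σ v) (weight≤ v) ⟩
        σ v * M              ≡⟨ *-comm (σ v) M ⟩
        M * σ v              ∎
      pointwise : ∀ v {x y} → Position s v x y → σ v * weight v + x * (M * σ v) ≤ M * σ v
      pointwise v (here refl) = ≤-reflexive (trans (cong (λ z → σ v * z + 1 * (M * σ v)) weight-sink) (drop (σ v) (M * σ v)))
        where
          drop : ∀ a b → a * 0 + 1 * b ≡ b
          drop = solve-∀
      pointwise v (near _ _) = awayFromSink v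
      pointwise v (far _ _)  = awayFromSink v
      withSink : Φ σ + M * σ s ≤ M * ∑ σ
      withSink = begin
        Φ σ + M * σ s                                  ≡⟨ cong (Φ σ +_) (∑-δ s (λ v → M * σ v)) ⟨
        Φ σ + ∑ (λ v → δ s v * (M * σ v))              ≡⟨ ∑-+ (λ v → σ v * weight v) (λ v → δ s v * (M * σ v)) ⟨
        ∑ (λ v → σ v * weight v + δ s v * (M * σ v))   ≤⟨ ∑-mono (λ v → pointwise v (position s v)) ⟩
        ∑ (λ v → M * σ v)                              ≡⟨ ∑-*ˡ M σ ⟩
        M * ∑ σ                                        ∎

  -- While Φ > 2 ^ b, every step lowers D * Φ by at least 2 ^ b, so Φ is halved within D steps.
  length≤ : ∀ b j {σ σ′ m} → Run s σ m σ′ → D * Φ σ ≤ (D + j) * 2 ^ b → m ≤ j + (D * b + 1)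
  length≤′ : ∀ b {σ σ′ m} → Run s σ m σ′ → Φ σ ≤ 2 ^ b → m ≤ D * b + 1

  length≤ b j done DΦ≤ = z≤n
  length≤ b zero {σ} run@(step _ _) DΦ≤ = length≤′ b run (*-cancelˡ-≤ D {{D≢0}} (begin
    D * Φ σ            ≤⟨ DΦ≤ ⟩
    (D + 0) * 2 ^ b    ≡⟨ cong (_* 2 ^ b) (+-identityʳ D) ⟩
    D * 2 ^ b          ∎))
    where
      open ≤-Reasoning
      D≢0 : NonZero D
      D≢0 = >-nonZero (*-mono-≤ {1} {8} (s≤s z≤n) (*-mono-≤ (m^n>0 2 (suc n)) (m^n>0 2 (suc n))))
  -- `D * Φ` exceeds `D * 2 ^ b` by at most `suc j` units of `2 ^ b`, and each step spends one.
  length≤ b (suc j) {σ} run@(step {σ' = τ} st rest) DΦ≤ with Φ σ ≤? 2 ^ b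
  ... | yes Φ≤ = ≤-trans (length≤′ b run Φ≤) (m≤n+m _ (suc j))
  ... | no Φ≰  = s≤s (length≤ b j rest (+-cancelʳ-≤ (2 ^ b) _ _ (begin
    D * Φ τ + 2 ^ b             ≤⟨ +-monoʳ-≤ (D * Φ τ) (≤-trans (≰⇒≥ Φ≰) (Φ≤D*chipsFired st)) ⟩
    D * Φ τ + D * chipsFired st ≡⟨ *-distribˡ-+ D (Φ τ) _ ⟨
    D * (Φ τ + chipsFired st)   ≤⟨ *-monoʳ-≤ D (Φ-decrease st) ⟩
    D * Φ σ                     ≤⟨ DΦ≤ ⟩
    (D + suc j) * 2 ^ b         ≡⟨ split D j (2 ^ b) ⟩
    (D + j) * 2 ^ b + 2 ^ b     ∎)))
    where
      open ≤-Reasoning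
      split : ∀ d j p → (d + suc j) * p ≡ (d + j) * p + p
      split = solve-∀

  length≤′ b done _ = z≤n
  -- Every step lowers `Φ` by at least 1, so `Φ ≤ 1` allows one last step: the source of the `+ 1`.
  length≤′ zero (step st done) _ = m≤n+m 1 (D * 0)
  length≤′ zero {σ} (step {σ' = τ} st (step {σ' = υ} st′ _)) Φ≤1 = contradiction 2≤1 (<⇒≱ ≤-refl)
    where
      open ≤-Reasoning
      2≤1 : 2 ≤ 1
      2≤1 = begin
        1 + 1                   ≤⟨ +-mono-≤ (≤-trans (1≤chipsFired st′) (m+n≤o⇒n≤o (Φ υ) (Φ-decrease st′))) (1≤chipsFired st) ⟩
        Φ τ + chipsFired st     ≤⟨ Φ-decrease st ⟩
        Φ σ                     ≤⟨ Φ≤1 ⟩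
        1                       ∎
  length≤′ (suc b) {σ} {m = m} run Φ≤ = begin
    -- The countdown starts at `j = D` because `D * 2 ^ suc b` is `(D + D) * 2 ^ b`.
    m                 ≤⟨ length≤ b D run (≤-trans (*-monoʳ-≤ D Φ≤) (≤-reflexive (double D (2 ^ b)))) ⟩
    D + (D * b + 1)   ≡⟨ collect D b ⟩
    D * suc b + 1     ∎
    where
      open ≤-Reasoning
      double : ∀ d p → d * (2 * p) ≡ (d + d) * p
      double = solve-∀
      collect : ∀ d b → d + (d * b + 1) ≡ d * suc b + 1
      collect = solve-∀

-- The logarithmic bound on the number of iterations.

n<2^[1+⌊log₂n⌋] : ∀ n → n < 2 ^ suc ⌊log₂ n ⌋
n<2^[1+⌊log₂n⌋] n = ≰⇒> λ 2^≤n → <⇒≱ ≤-refl (begin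
  suc ⌊log₂ n ⌋                  ≡⟨ ⌊log₂[2^n]⌋≡n (suc ⌊log₂ n ⌋) ⟨
  ⌊log₂ 2 ^ suc ⌊log₂ n ⌋ ⌋      ≤⟨ ⌊log₂⌋-mono-≤ 2^≤n ⟩
  ⌊log₂ n ⌋                      ∎)
  where open ≤-Reasoning

theorem4p10 : ∃ λ (C : ℕ) → ∀ (d : ℕ) (s : Vertex d) (σ σ' : Config d) (m : ℕ)
    → Run s σ m σ'
    → m ≤ C * ((2 ^ d) * (2 ^ d)) * ⌊log₂ ((2 ^ d) * totalChips d s σ) ⌋
-- With `D = 8 * W` and `Φ ≤ 2 ^ (3 + ℓ)`, the estimate `3 + ℓ ≤ 4 * ℓ` gives 32, and the final
-- `+ 1` is at most `W * ℓ`.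
theorem4p10 = 33 , bound
  where
    open ≤-Reasoning
    bound : ∀ d (s : Vertex d) σ σ' m → Run s σ m σ' → m ≤ 33 * (2 ^ d * 2 ^ d) * ⌊log₂ (2 ^ d * totalChips d s σ) ⌋
    -- Split off first: the logarithm may be 0 here, whereas a step forces `ℓ ≥ 1`.
    bound d       s  σ σ' _ done = z≤n
    bound zero    [] σ σ' _ (step st _) = contradiction (sole (GreedyStep.u st)) (GreedyStep.u≢s st)
      where
        sole : ∀ (v : Vertex 0) → v ≡ []
        sole [] = refl
    bound (suc n) s σ σ' m run@(step st _) = begin
      m                                ≤⟨ length≤′ (suc (suc (suc ℓ))) run Φ≤2^ ⟩
      8 * W * (3 + ℓ) + 1              ≤⟨ +-mono-≤ (*-monoʳ-≤ (8 * W) (+-monoˡ-≤ ℓ (*-monoʳ-≤ 3 1≤ℓ))) (*-mono-≤ 1≤W 1≤ℓ) ⟩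
      8 * W * (3 * ℓ + ℓ) + W * ℓ      ≡⟨ collect W ℓ ⟩
      33 * W * ℓ                       ∎
      where
        open Potential s
        N = totalChips (suc n) s σ
        ℓ = ⌊log₂ (2 ^ suc n * N) ⌋
        W = 2 ^ suc n * 2 ^ suc n
        1≤W : 1 ≤ W
        1≤W = *-mono-≤ (m^n>0 2 (suc n)) (m^n>0 2 (suc n))
        collect : ∀ w l → 8 * w * (3 * l + l) + w * l ≡ 33 * w * l
        collect = solve-∀
        Φ≤2^ : Φ σ ≤ 2 ^ suc (suc (suc ℓ))
        Φ≤2^ = begin
          Φ σ                    ≤⟨ Φ≤totalChips σ ⟩
          4 * (2 ^ suc n * N)    ≤⟨ *-monoʳ-≤ 4 (<⇒≤ (n<2^[1+⌊log₂n⌋] (2 ^ suc n * N))) ⟩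
          4 * 2 ^ suc ℓ          ≡⟨ *-assoc 2 2 (2 ^ suc ℓ) ⟩
          2 ^ suc (suc (suc ℓ))  ∎
        -- Without chips `Φ` would be 0, yet a step lowers it by at least 1.
        1≤N : 1 ≤ N
        1≤N with N | Φ≤totalChips σ
        ... | suc _ | _ = s≤s z≤n
        ... | zero  | Φ≤0 = begin
          1                     ≤⟨ 1≤chipsFired st ⟩
          chipsFired st         ≤⟨ m+n≤o⇒n≤o _ (Φ-decrease st) ⟩
          Φ σ                   ≤⟨ Φ≤0 ⟩
          4 * (2 ^ suc n * 0)   ≡⟨ cong (4 *_) (*-zeroʳ (2 ^ suc n)) ⟩
          0                     ∎
        1≤ℓ : 1 ≤ ℓ
        1≤ℓ = ⌊log₂⌋-mono-≤ {2} (*-mono-≤ {2} (*-mono-≤ {2} ≤-refl (m^n>0 2 n)) 1≤N)
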